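{- For any integer $n>2$ and any integer $k$ with $2\le k\le n/64$, every $(n,k)$-selective family $\mathcal F$ satisfies $$|\mathcal F|\ \ge\ \frac{k}{24}\log_2\frac{n}{k}.$$
   Context: Write $[n]=\{1,\dots,n\}$. For integers $k\le n$, a family $\mathcal F$ of subsets of $[n]$ is $(n,k)$-selective if for every non-empty $Z\subseteq[n]$ with $|Z|\le k$ there is $F\in\mathcal F$ with $|Z\cap F|=1$. -}

module Defs where

open import Algebra.Definitions.RawSemiring using (_^_)
open import Data.Fin.Subset using (Subset; Nonempty; _∩_; ∣_∣)
open import Data.Integer.Base as ℤ using (ℤ; +_; -[1+_])
open import Data.List.Base using (List; length)
open import Data.List.Membership.Propositional using (_∈_)
open import Data.List.Relation.Unary.Unique.Propositional using (Unique)
open import Data.Nat.Base as ℕ using (ℕ; suc; _≤_)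
open import Data.Product.Base using (∃-syntax; _×_)
open import Data.Rational.Unnormalised.Base as ℚ
  using (ℚᵘ; _/_; _÷_; ½; ↥_; ↧ₙ_; Positive; +-*-rawSemiring)
open import Relation.Binary.PropositionalEquality.Core using (_≡_)

-- A family is a set of subsets of [n] (with [n] rendered as Fin n), given by a
-- duplicate-free enumeration, so that the length is the cardinality.
record Family (n : ℕ) : Set where
  field
    members  : List (Subset n)
    distinct : Unique members

  size : ℕ
  size = length members

open Family public

Selective : ∀ {n} → ℕ → Family n → Set
Selective {n} k 𝓕 =
  (Z : Subset n) → Nonempty Z → ∣ Z ∣ ≤ k →
  ∃[ F ] (F ∈ members 𝓕 × ∣ Z ∩ F ∣ ≡ 1)

-- A real number r is represented by its set of rational upper bounds,
-- { q ∣ r ≤ q }; the inequality is non-strict, so a rational q satisfies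
-- q ≥ r exactly when it belongs to the set.
Real : Set₁
Real = ℚᵘ → Set

infixl 7 _·_
infix  4 _≥ᴿ_

_≥ᴿ_ : ℚᵘ → Real → Set
q ≥ᴿ r = r q

-- c r ≤ q  iff  r ≤ q / c,  for rational c > 0.
_·_ : (c : ℚᵘ) .{{_ : Positive c}} → Real → Real
_·_ c r q = r (_÷_ q c {{nonZero c}})
  where
  nonZero : (c : ℚᵘ) .{{_ : Positive c}} → ℚ.NonZero c
  nonZero (ℚ.mkℚᵘ (ℤ.+[1+ _ ]) _) = _

2^_ : ℤ → ℚᵘ
2^ (+ a)    = _^_ +-*-rawSemiring (+ 2 / 1) a
2^ -[1+ a ] = _^_ +-*-rawSemiring ½ (suc a)

-- For x > 0 and q = a / b with b > 0:  log₂ x ≤ a / b  iff  x ^ b ≤ 2 ^ a.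
-- The condition does not depend on the fraction chosen to represent q.
-- Only positive x are meaningful.
log₂ : ℚᵘ → Real
log₂ x q = _^_ +-*-rawSemiring x (↧ₙ q) ℚ.≤ 2^ (↥ q)

instance
  +-positive : ∀ {a} .{{_ : ℕ.NonZero a}} → ℤ.Positive (+ a)
  +-positive {suc _} = _

{-# OPTIONS --safe #-}
-- If two distinct sets A and B satisfy |A| + |B| ≤ k, then some F ∈ 𝓕 meets
-- their symmetric difference in exactly one point, so |A ∩ F| and |B ∩ F|
-- differ in parity.  Hence the parity vectors (|A ∩ F| mod 2) for F ∈ 𝓕
-- separate all sets of size at most k / 2, and it suffices to exhibit many such
-- sets: cut out h = ⌊k/2⌋ disjoint blocks of b = ⌊n/k⌋ + 1 points each and
-- choose one point per block.  This gives b ^ h ≤ 2 ^ |𝓕|, and b ≥ n / k and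
-- 24 h ≥ k yield (n / k) ^ k ≤ 2 ^ (24 |𝓕|).
module Submission where

open import Defs
open import Algebra.Definitions.RawSemiring using () renaming (_^_ to pow)
open import Data.Bool.Base using (_xor_)
open import Data.Bool.Properties using (∧-distribʳ-xor)
open import Data.Fin.Base using (Fin; zero; suc; toℕ; combine; funToFin; finToFun)
open import Data.Fin.Properties
  using (toℕ-fromℕ<; funToFin-finToFin; finToFun-funToFin; injective⇒≤)
open import Data.Fin.Subset
  using (Subset; _∈_; inside; outside; ⊥; ⁅_⁆; _∩_; ∣_∣)
open import Data.Fin.Subset.Properties
  using (nonempty?; Empty-unique; ∣⊥∣≡0; ∣⁅x⁆∣≡1; x∈⁅x⁆; x∈⁅y⁆⇒x≡y)
open import Data.Integer.Base as ℤ using (+_)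
import Data.Integer.Properties as ℤ
import Data.List.Base as List
open import Data.List.Relation.Unary.Any using (index)
open import Data.List.Relation.Unary.Any.Properties using (lookup-index)
open import Data.Nat.Base
  using (ℕ; zero; suc; NonZero; _≤_; _<_; _+_; _*_; _^_; _%_; ⌊_/2⌋; z≤n; s≤s)
import Data.Nat.Base as ℕ
open import Data.Nat.DivMod
  using (_mod_; m≡m%n+[m/n]*n; m%n<n; m%n≤n; m/n*n≤m; %-distribˡ-+; [m+kn]%n≡m%n; m*n%n≡0)
open import Data.Nat.Properties
open import Data.Product.Base using (_,_)
open import Data.Rational.Unnormalised.Base as ℚ using (ℚᵘ; _/_; *≤*; +-*-rawSemiring)
import Data.Rational.Unnormalised.Properties as ℚ
open import Data.Vec.Base using ([]; _∷_; _++_; concat; tabulate; zipWith)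
open import Data.Vec.Properties using (zipWith-distribʳ; ∷-injectiveʳ; ++-injective; ++-injectiveˡ)
open import Function.Base using (_∘_)
open import Relation.Binary.PropositionalEquality
  using (_≡_; _≢_; _≗_; refl; sym; trans; cong; cong₂; subst; subst₂; module ≡-Reasoning)
open import Relation.Nullary using (yes; no; contradiction)

-- Symmetric differences and parities of intersections.

infixl 6 _⊕_

_⊕_ : ∀ {n} → Subset n → Subset n → Subset n
_⊕_ = zipWith _xor_

-- A common point is counted twice on the right and is missing from `p ⊕ q`. The correction is a
-- multiple of 2, so the same identity serves the size bound and the parity argument.
∣p⊕q∣+∣p∩q∣*2 : ∀ {n} (p q : Subset n) → ∣ p ⊕ q ∣ + ∣ p ∩ q ∣ * 2 ≡ ∣ p ∣ + ∣ q ∣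
∣p⊕q∣+∣p∩q∣*2 []            []            = refl
∣p⊕q∣+∣p∩q∣*2 (outside ∷ p) (outside ∷ q) = ∣p⊕q∣+∣p∩q∣*2 p q
∣p⊕q∣+∣p∩q∣*2 (inside  ∷ p) (outside ∷ q) = cong suc (∣p⊕q∣+∣p∩q∣*2 p q)
∣p⊕q∣+∣p∩q∣*2 (outside ∷ p) (inside  ∷ q) =
  trans (cong suc (∣p⊕q∣+∣p∩q∣*2 p q)) (sym (+-suc ∣ p ∣ ∣ q ∣))
∣p⊕q∣+∣p∩q∣*2 (inside  ∷ p) (inside  ∷ q) = begin
  ∣ p ⊕ q ∣ + suc (suc (∣ p ∩ q ∣ * 2))   ≡⟨ +-suc ∣ p ⊕ q ∣ _ ⟩
  suc (∣ p ⊕ q ∣ + suc (∣ p ∩ q ∣ * 2))   ≡⟨ cong suc (+-suc ∣ p ⊕ q ∣ _) ⟩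
  suc (suc (∣ p ⊕ q ∣ + ∣ p ∩ q ∣ * 2))   ≡⟨ cong (λ x → 2 + x) (∣p⊕q∣+∣p∩q∣*2 p q) ⟩
  suc (suc (∣ p ∣ + ∣ q ∣))               ≡⟨ cong suc (+-suc ∣ p ∣ ∣ q ∣) ⟨
  suc (∣ p ∣ + (suc ∣ q ∣))               ∎
  where open ≡-Reasoning

∣p⊕q∣≤∣p∣+∣q∣ : ∀ {n} (p q : Subset n) → ∣ p ⊕ q ∣ ≤ ∣ p ∣ + ∣ q ∣
∣p⊕q∣≤∣p∣+∣q∣ p q = ≤-trans (m≤m+n _ _) (≤-reflexive (∣p⊕q∣+∣p∩q∣*2 p q))

p⊕q≡⊥⇒p≡q : ∀ {n} (p q : Subset n) → p ⊕ q ≡ ⊥ → p ≡ q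
p⊕q≡⊥⇒p≡q []            []            _  = refl
p⊕q≡⊥⇒p≡q (outside ∷ p) (outside ∷ q) eq = cong (outside ∷_) (p⊕q≡⊥⇒p≡q p q (∷-injectiveʳ eq))
p⊕q≡⊥⇒p≡q (inside  ∷ p) (inside  ∷ q) eq = cong (inside ∷_) (p⊕q≡⊥⇒p≡q p q (∷-injectiveʳ eq))
p⊕q≡⊥⇒p≡q (outside ∷ p) (inside  ∷ q) ()
p⊕q≡⊥⇒p≡q (inside  ∷ p) (outside ∷ q) ()

mod≡mod⇒%≡% : ∀ a b d .{{_ : NonZero d}} → a mod d ≡ b mod d → a % d ≡ b % d
mod≡mod⇒%≡% a b d eq = begin
  a % d         ≡⟨ toℕ-fromℕ< (m%n<n a d) ⟨
  toℕ (a mod d) ≡⟨ cong toℕ eq ⟩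
  toℕ (b mod d) ≡⟨ toℕ-fromℕ< (m%n<n b d) ⟩
  b % d         ∎
  where open ≡-Reasoning

[m+m]%2≡0 : ∀ m → (m + m) % 2 ≡ 0
[m+m]%2≡0 m = begin
  (m + m) % 2         ≡⟨ cong (λ x → (m + x) % 2) (+-identityʳ m) ⟨
  (2 * m) % 2         ≡⟨ cong (_% 2) (*-comm 2 m) ⟩
  (m * 2) % 2         ≡⟨ m*n%n≡0 m 2 ⟩
  0                   ∎
  where open ≡-Reasoning

-- Intersecting with `r` distributes over `⊕`, so modulo 2 the single point equals
-- `∣ p ∩ r ∣ + ∣ q ∩ r ∣`, a sum that equal parities would make even.
∣[p⊕q]∩r∣≡1⇒parities-differ : ∀ {n} (p q r : Subset n) → ∣ (p ⊕ q) ∩ r ∣ ≡ 1 →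
                              ∣ p ∩ r ∣ mod 2 ≢ ∣ q ∩ r ∣ mod 2
∣[p⊕q]∩r∣≡1⇒parities-differ p q r one same = 1+n≢0 {0} (begin
  1                               ≡⟨ [m+kn]%n≡m%n 1 c 2 ⟨
  (1 + c * 2) % 2                 ≡⟨ cong (λ x → (x + c * 2) % 2) one ⟨
  (∣ (p ⊕ q) ∩ r ∣ + c * 2) % 2   ≡⟨ cong (λ x → (∣ x ∣ + c * 2) % 2)
                                       (zipWith-distribʳ ∧-distribʳ-xor r p q) ⟩
  (∣ (p ∩ r) ⊕ (q ∩ r) ∣ + c * 2) % 2
                                  ≡⟨ cong (_% 2) (∣p⊕q∣+∣p∩q∣*2 (p ∩ r) (q ∩ r)) ⟩
  (a + b) % 2                     ≡⟨ %-distribˡ-+ a b 2 ⟩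
  (a % 2 + b % 2) % 2             ≡⟨ cong (λ x → (x + b % 2) % 2) (mod≡mod⇒%≡% a b 2 same) ⟩
  (b % 2 + b % 2) % 2             ≡⟨ [m+m]%2≡0 (b % 2) ⟩
  0                               ∎)
  where
  open ≡-Reasoning
  a = ∣ p ∩ r ∣
  b = ∣ q ∩ r ∣
  c = ∣ (p ∩ r) ∩ (q ∩ r) ∣

-- Indexing by positions in the enumeration, with values in `Fin 2`, leaves `2 ^ size 𝓕` possible
-- signatures.
signature : ∀ {n} (𝓕 : Family n) → Subset n → Fin (size 𝓕) → Fin 2
signature 𝓕 p i = ∣ p ∩ List.lookup (members 𝓕) i ∣ mod 2

signature-separates : ∀ {n k} (𝓕 : Family n) → Selective k 𝓕 →
                      ∀ p q → ∣ p ∣ + ∣ q ∣ ≤ k →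
                      signature 𝓕 p ≗ signature 𝓕 q → p ≡ q
signature-separates 𝓕 selective p q small same with nonempty? (p ⊕ q)
... | no  empty    = p⊕q≡⊥⇒p≡q p q (Empty-unique empty)
... | yes nonempty
  with F , F∈𝓕 , one ← selective (p ⊕ q) nonempty (≤-trans (∣p⊕q∣≤∣p∣+∣q∣ p q) small)
  -- The position of the selected `F` is a coordinate where the two signatures disagree.
  = contradiction (same (index F∈𝓕))
      (∣[p⊕q]∩r∣≡1⇒parities-differ p q _
        (subst (λ G → ∣ (p ⊕ q) ∩ G ∣ ≡ 1) (lookup-index F∈𝓕) one))

-- Counting functions between finite sets.

funToFin-cong : ∀ {m n} {f g : Fin m → Fin n} → f ≗ g → funToFin f ≡ funToFin g
funToFin-cong {zero}  eq = refl
funToFin-cong {suc m} eq = cong₂ combine (eq zero) (funToFin-cong (eq ∘ suc))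

finToFun-injective : ∀ {m n} {i j : Fin (m ^ n)} →
                     finToFun {m} {n} i ≗ finToFun j → i ≡ j
finToFun-injective {m} {n} {i} {j} eq = begin
  i                               ≡⟨ funToFin-finToFin {n} i ⟨
  funToFin {n} {m} (finToFun i)   ≡⟨ funToFin-cong eq ⟩
  funToFin {n} {m} (finToFun j)   ≡⟨ funToFin-finToFin {n} j ⟩
  j                               ∎
  where open ≡-Reasoning

-- Coding functions as elements of `Fin (b ^ a)` and `Fin (d ^ c)` turns `Φ` into an injection of
-- finite sets, to which the pigeonhole principle applies.
≗-injective⇒^≤^ : ∀ {a b c d} (Φ : (Fin a → Fin b) → Fin c → Fin d) →
                  (∀ f g → Φ f ≗ Φ g → f ≗ g) → b ^ a ≤ d ^ c
≗-injective⇒^≤^ {a} {b} {c} {d} Φ Φ-injective =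
  injective⇒≤ {f = λ i → funToFin (Φ (finToFun i))} λ {i} {j} eq →
  finToFun-injective (Φ-injective _ _ λ x → begin
    Φ (finToFun i) x                       ≡⟨ finToFun-funToFin (Φ (finToFun i)) x ⟨
    finToFun (funToFin (Φ (finToFun i))) x ≡⟨ cong (λ y → finToFun {d} {c} y x) eq ⟩
    finToFun (funToFin (Φ (finToFun j))) x ≡⟨ finToFun-funToFin (Φ (finToFun j)) x ⟩
    Φ (finToFun j) x                       ∎)
  where open ≡-Reasoning

-- Transversals of disjoint blocks.

∣p++q∣ : ∀ {m n} (p : Subset m) (q : Subset n) → ∣ p ++ q ∣ ≡ ∣ p ∣ + ∣ q ∣
∣p++q∣ []            q = refl
∣p++q∣ (outside ∷ p) q = ∣p++q∣ p q
∣p++q∣ (inside  ∷ p) q = cong suc (∣p++q∣ p q)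

⁅⁆-injective : ∀ {n} {x y : Fin n} → ⁅ x ⁆ ≡ ⁅ y ⁆ → x ≡ y
⁅⁆-injective {x = x} {y} eq = x∈⁅y⁆⇒x≡y y (subst (x ∈_) eq (x∈⁅x⁆ x))

-- Concatenating the indicator vectors of `h` singletons makes the blocks consecutive, hence
-- disjoint by construction.
transversal : ∀ {h b} → (Fin h → Fin b) → Subset (h * b)
transversal f = concat (tabulate (⁅_⁆ ∘ f))

∣transversal∣ : ∀ {h b} (f : Fin h → Fin b) → ∣ transversal f ∣ ≡ h
∣transversal∣ {zero}  f = refl
∣transversal∣ {suc h} f = trans (∣p++q∣ ⁅ f zero ⁆ (transversal (f ∘ suc)))
                               (cong₂ _+_ (∣⁅x⁆∣≡1 (f zero)) (∣transversal∣ (f ∘ suc)))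

transversal-injective : ∀ {h b} (f g : Fin h → Fin b) → transversal f ≡ transversal g → f ≗ g
transversal-injective {suc h} f g eq i
  with eq₀ , eqₛ ← ++-injective ⁅ f zero ⁆ ⁅ g zero ⁆ eq
  with i
... | zero  = ⁅⁆-injective eq₀
... | suc j = transversal-injective (f ∘ suc) (g ∘ suc) eqₛ j

-- Two transversals have total size `h + h ≤ k`, so the `b ^ h` choice functions receive pairwise
-- different signatures.
selective⇒^≤2^ : ∀ {n k} (𝓕 : Family n) → Selective k 𝓕 →
                 ∀ h b → h + h ≤ k → h * b ≤ n → b ^ h ≤ 2 ^ size 𝓕
selective⇒^≤2^ {n} {k} 𝓕 selective h b 2h≤k hb≤n
  -- The `d` points beyond the blocks belong to none of the chosen sets.
  with d , refl ← m≤n⇒∃[o]m+o≡n hb≤n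
  = ≗-injective⇒^≤^ (signature 𝓕 ∘ padded) λ f g same →
      transversal-injective f g
        (++-injectiveˡ (transversal f) (transversal g)
          (signature-separates 𝓕 selective (padded f) (padded g)
            (subst (_≤ k) (sym (cong₂ _+_ (∣padded∣ f) (∣padded∣ g))) 2h≤k) same))
  where
  padded : (Fin h → Fin b) → Subset (h * b + d)
  padded f = transversal f ++ ⊥

  ∣padded∣ : ∀ f → ∣ padded f ∣ ≡ h
  ∣padded∣ f = begin
    ∣ transversal f ++ ⊥ {d} ∣    ≡⟨ ∣p++q∣ (transversal f) ⊥ ⟩
    ∣ transversal f ∣ + ∣ ⊥ {d} ∣ ≡⟨ cong₂ _+_ (∣transversal∣ f) (∣⊥∣≡0 d) ⟩
    h + 0                         ≡⟨ +-identityʳ h ⟩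
    h                             ∎
    where open ≡-Reasoning

-- Integer estimates for the block parameters.

-- Equality holds at 3; passing from `n` to `2 + n` adds 2 on the left and 3 on the right.
n≤3*⌊n/2⌋ : ∀ {n} → 2 ≤ n → n ≤ 3 * ⌊ n /2⌋
n≤3*⌊n/2⌋ {1}                   (s≤s ())
n≤3*⌊n/2⌋ {2}                   _ = n≤1+n 2
n≤3*⌊n/2⌋ {3}                   _ = ≤-refl
n≤3*⌊n/2⌋ {suc (suc n@(suc (suc _)))} _ = begin
  2 + n               ≤⟨ +-mono-≤ (n≤1+n 2) (n≤3*⌊n/2⌋ {n} (s≤s (s≤s z≤n))) ⟩
  3 + 3 * ⌊ n /2⌋     ≡⟨ *-suc 3 ⌊ n /2⌋ ⟨
  3 * suc ⌊ n /2⌋     ∎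
  where open ≤-Reasoning

⌊n/2⌋+⌊n/2⌋≤n : ∀ n → ⌊ n /2⌋ + ⌊ n /2⌋ ≤ n
⌊n/2⌋+⌊n/2⌋≤n n = ≤-trans (+-monoʳ-≤ ⌊ n /2⌋ (⌊n/2⌋≤⌈n/2⌉ n)) (≤-reflexive (⌊n/2⌋+⌈n/2⌉≡n n))

m≤[1+m/n]*n : ∀ m n .{{_ : NonZero n}} → m ≤ suc (m ℕ./ n) * n
m≤[1+m/n]*n m n = begin
  m                       ≡⟨ m≡m%n+[m/n]*n m n ⟩
  m % n + m ℕ./ n * n     ≤⟨ +-monoˡ-≤ _ (m%n≤n m n) ⟩
  n + m ℕ./ n * n         ∎
  where open ≤-Reasoning

-- The blocks fit into the ground set: using only half of `k` pays for the extra point per block,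
-- since `k` blocks of this length have at most `n + k ≤ 2 * n` points.
⌊k/2⌋*[1+n/k]≤n : ∀ n k .{{_ : NonZero k}} → k ≤ n → ⌊ k /2⌋ * suc (n ℕ./ k) ≤ n
⌊k/2⌋*[1+n/k]≤n n k k≤n = *-cancelˡ-≤ 2 (begin
  2 * (h * suc q)    ≡⟨ *-assoc 2 h (suc q) ⟨
  2 * h * suc q      ≡⟨ cong (λ x → (h + x) * suc q) (+-identityʳ h) ⟩
  (h + h) * suc q    ≤⟨ *-monoˡ-≤ (suc q) (⌊n/2⌋+⌊n/2⌋≤n k) ⟩
  k * suc q          ≡⟨ *-comm k (suc q) ⟩
  k + q * k          ≤⟨ +-mono-≤ k≤n (m/n*n≤m n k) ⟩
  n + n              ≡⟨ cong (λ x → n + x) (+-identityʳ n) ⟨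
  2 * n              ∎)
  where
  open ≤-Reasoning
  h = ⌊ k /2⌋
  q = n ℕ./ k

[1+n/k]^k≤2^[size*24] : ∀ {n k} .{{_ : NonZero k}} → 2 ≤ k → k ≤ n →
                        (𝓕 : Family n) → Selective k 𝓕 →
                        suc (n ℕ./ k) ^ k ≤ 2 ^ (size 𝓕 * 24)
[1+n/k]^k≤2^[size*24] {n} {k} 2≤k k≤n 𝓕 selective = begin
  -- `k ≤ 3 * h` and `24 = 3 + 21` give the exponent `24 * h`, matching the constant of the theorem.
  b ^ k               ≤⟨ ^-monoʳ-≤ b (≤-trans (n≤3*⌊n/2⌋ 2≤k) (*-monoˡ-≤ h (m≤m+n 3 21))) ⟩
  b ^ (24 * h)        ≡⟨ cong (b ^_) (*-comm 24 h) ⟩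
  b ^ (h * 24)        ≡⟨ ^-*-assoc b h 24 ⟨
  (b ^ h) ^ 24        ≤⟨ ^-monoˡ-≤ 24 (selective⇒^≤2^ 𝓕 selective h b
                                          (⌊n/2⌋+⌊n/2⌋≤n k) (⌊k/2⌋*[1+n/k]≤n n k k≤n)) ⟩
  (2 ^ size 𝓕) ^ 24   ≡⟨ ^-*-assoc 2 (size 𝓕) 24 ⟩
  2 ^ (size 𝓕 * 24)   ∎
  where
  open ≤-Reasoning
  b = suc (n ℕ./ k)
  h = ⌊ k /2⌋

-- Rational powers and the logarithmic bound.

infixr 8 _^ℚ_

_^ℚ_ : ℚᵘ → ℕ → ℚᵘ
_^ℚ_ = pow +-*-rawSemiring

-- Products of denominators 1 compute to 1, so this holds as `≡` and not merely up to equivalence of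
-- fractions.
/1-^ : ∀ a j → (+ a / 1) ^ℚ j ≡ + (a ^ j) / 1
/1-^ a zero    = refl
/1-^ a (suc j) = begin
  (+ a / 1) ℚ.* (+ a / 1) ^ℚ j   ≡⟨ cong ((+ a / 1) ℚ.*_) (/1-^ a j) ⟩
  (+ a ℤ.* + (a ^ j)) / 1        ≡⟨ cong (_/ 1) (ℤ.pos-* a (a ^ j)) ⟨
  + (a * a ^ j) / 1              ∎
  where open ≡-Reasoning

^ℚ-nonNeg : ∀ p j .{{_ : ℚ.NonNegative p}} → ℚ.NonNegative (p ^ℚ j)
^ℚ-nonNeg p zero    = _
^ℚ-nonNeg p (suc j) = ℚ.nonNeg*nonNeg⇒nonNeg p (p ^ℚ j) {{^ℚ-nonNeg p j}}

^ℚ-monoˡ-≤ : ∀ {p q} j .{{_ : ℚ.NonNegative p}} → p ℚ.≤ q → p ^ℚ j ℚ.≤ q ^ℚ j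
^ℚ-monoˡ-≤         zero            p≤q = ℚ.≤-refl
^ℚ-monoˡ-≤ {p} {q} (suc j) {{p≥0}} p≤q =
  ℚ.*-mono-≤-nonNeg {{p≥0}} {{^ℚ-nonNeg p j}} p≤q (^ℚ-monoˡ-≤ j p≤q)

/1-mono-≤ : ∀ {a b} → a ≤ b → + a / 1 ℚ.≤ + b / 1
/1-mono-≤ a≤b = *≤* (ℤ.*-monoʳ-≤-nonNeg (+ 1) (ℤ.+≤+ a≤b))

n≤b*k⇒n/k≤b/1 : ∀ {n b} k .{{_ : NonZero k}} → n ≤ b * k → + n / k ℚ.≤ + b / 1
n≤b*k⇒n/k≤b/1 {n} {b} k@(suc _) n≤bk = *≤* (begin
  + n ℤ.* + 1   ≡⟨ ℤ.*-identityʳ (+ n) ⟩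
  + n           ≤⟨ ℤ.+≤+ n≤bk ⟩
  + (b * k)     ≡⟨ ℤ.pos-* b k ⟩
  + b ℤ.* + k   ∎)
  where open ℤ.≤-Reasoning

theorem3p3 : (n k : ℕ) .{{_ : NonZero k}} →
    2 < n → 2 ≤ k → 64 * k ≤ n →
    (𝓕 : Family n) → Selective k 𝓕 →
    + size 𝓕 / 1 ≥ᴿ (+ k / 24) · log₂ (+ n / k)
theorem3p3 n k@(suc _) _ 2≤k 64k≤n 𝓕 selective =
  -- The quotient size 𝓕 / (k / 24) reduces to the fraction (+ size 𝓕 ℤ.* + 24) / (k + 0).
  subst₂ (λ a j → (+ n / k) ^ℚ j ℚ.≤ 2^ a) (ℤ.pos-* (size 𝓕) 24) (sym (+-identityʳ k)) (begin
    -- Adding 1 to the rounded-down quotient makes `b` an upper bound for the rational `n / k`, so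
    -- the integer estimate transfers.
    (+ n / k) ^ℚ k               ≤⟨ ^ℚ-monoˡ-≤ k (n≤b*k⇒n/k≤b/1 k (m≤[1+m/n]*n n k)) ⟩
    (+ b / 1) ^ℚ k               ≡⟨ /1-^ b k ⟩
    + (b ^ k) / 1                ≤⟨ /1-mono-≤ ([1+n/k]^k≤2^[size*24] 2≤k k≤n 𝓕 selective) ⟩
    + (2 ^ (size 𝓕 * 24)) / 1    ≡⟨ /1-^ 2 (size 𝓕 * 24) ⟨
    (+ 2 / 1) ^ℚ (size 𝓕 * 24)   ∎)
  where
  open ℚ.≤-Reasoning
  b = suc (n ℕ./ k)
  k≤n = ≤-trans (m≤n*m k 64) 64k≤n
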